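{- Let $\Gamma=(G,\sigma)$ be a signed graph on $N$ vertices, $\mu$ a positive measure on $V$ and $1\le k\le N$. Then $h^{\sigma}_k(\mu)=0$ if and only if $\Gamma$ has $k$ balanced connected components.
   Context: A signed graph $\Gamma=(G,\sigma)$ consists of a finite simple undirected graph $G=(V,E)$ with $N=|V|$ vertices, positive symmetric edge weights $w_{uv}>0$ for $\{u,v\}\in E$ ($w_{uv}=0$ otherwise), and a signature $\sigma:E\to\{+1,-1\}$. The sign of a cycle is the product of the signs of its edges; a signed graph (or a connected component, with the induced signature) is balanced if all its cycles are positive. For a positive measure $\mu$, $\mathrm{vol}_\mu(S)=\sum_{u\in S}\mu(u)$. For $V_1,V_2\subseteq V$, $|E(V_1,V_2)|=\sum_{u\in V_1}\sum_{v\in V_2}w_{uv}$, $|E^{\pm}(V_1,V_2)|=\sum_{u\in V_1}\sum_{v\in V_2,\sigma(uv)=\pm1}w_{uv}$, $|E^\pm(V_1)|=|E^\pm(V_1,V_1)|$. A sub-bipartition $(V_1,V_2)$ is a pair of disjoint subsets with $V_1\cup V_2\ne\emptyset$, and $$\beta^{\sigma}(V_1,V_2)=\frac{2|E^{+}(V_1,V_2)|+|E^-(V_1)|+|E^-(V_2)|+|E(V_1\cup V_2,\overline{V_1\cup V_2})|}{\mathrm{vol}_{\mu}(V_1\cup V_2)}.$$ $h^{\sigma}_k(\mu)$ is the minimum of $\max_{1\le i\le k}\beta^{\sigma}(V_{2i-1},V_{2i})$ over all $k$-tuples of sub-bipartitions $(V_1,V_2),\dots,(V_{2k-1},V_{2k})$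 with $V_1\cup V_2,\dots,V_{2k-1}\cup V_{2k}$ pairwise disjoint.
   Formalization: The edge weights $w_{uv}$ and the positive measure μ take values in the rationals. -}

module Defs where

open import Data.Nat using (ℕ; zero; suc)
open import Data.Bool using (Bool; true; false; if_then_else_)
open import Data.Fin using (Fin; zero; suc)
open import Data.Fin.Subset using (Subset; _∈_; _∪_; _∩_; ∁; ⊥; Nonempty)
open import Data.Vec using (lookup)
open import Data.List using (List; []; _∷_; length)
open import Data.List.Relation.Unary.Unique.Propositional using (Unique)
open import Data.Rational using (ℚ; 0ℚ; 1ℚ; _+_; _*_; _÷_; _⊔_; _≤_; _<_; ≢-nonZero)
open import Data.Rational.Properties using (_≟_)
open import Data.Sign using (Sign) renaming (_*_ to _*ˢ_)
open import Data.Product using (Σ; ∃; _×_; _,_)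
open import Data.Unit using (⊤)
open import Relation.Nullary using (¬_; yes; no)
open import Relation.Binary.PropositionalEquality using (_≡_; _≢_)
open import Function.Bundles using (_⇔_)

-- A weighted signed graph on vertex set Fin N:
-- w u v > 0 iff {u,v} is an edge (weight w u v); w u v = 0 otherwise.
-- σ u v is the sign of the edge {u,v} (irrelevant on non-edges).
record SignedGraph (N : ℕ) : Set where
  field
    w       : Fin N → Fin N → ℚ
    σ       : Fin N → Fin N → Sign
    w-nonneg : ∀ u v → 0ℚ ≤ w u v
    w-sym    : ∀ u v → w u v ≡ w v u
    w-loop   : ∀ u → w u u ≡ 0ℚ          -- simple graph: no loops
    σ-sym    : ∀ u v → σ u v ≡ σ v u

open SignedGraph public

-- positive measure on the vertices
PositiveMeasure : (N : ℕ) → (Fin N → ℚ) → Set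
PositiveMeasure N μ = ∀ u → 0ℚ < μ u

-- finite sum over Fin n
sumFin : ∀ {n} → (Fin n → ℚ) → ℚ
sumFin {zero}  f = 0ℚ
sumFin {suc n} f = f zero + sumFin (λ i → f (suc i))

-- finite maximum over Fin n (0 for n = 0; only used with n ≥ 1)
maxFin : ∀ {n} → (Fin n → ℚ) → ℚ
maxFin {zero}        f = 0ℚ
maxFin {suc zero}    f = f zero
maxFin {suc (suc n)} f = f zero ⊔ maxFin (λ i → f (suc i))

ind : ∀ {N} → Subset N → Fin N → ℚ
ind S u = if lookup S u then 1ℚ else 0ℚ

isPos : Sign → ℚ
isPos Sign.+ = 1ℚ
isPos Sign.- = 0ℚ

isNeg : Sign → ℚ
isNeg Sign.+ = 0ℚ
isNeg Sign.- = 1ℚ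

module _ {N : ℕ} (Γ : SignedGraph N) where

  -- |E(V1,V2)| = Σ_{u∈V1} Σ_{v∈V2} w_uv
  E : Subset N → Subset N → ℚ
  E V₁ V₂ = sumFin λ u → sumFin λ v → ind V₁ u * ind V₂ v * w Γ u v

  -- |E^+(V1,V2)|
  E⁺ : Subset N → Subset N → ℚ
  E⁺ V₁ V₂ = sumFin λ u → sumFin λ v → ind V₁ u * ind V₂ v * isPos (σ Γ u v) * w Γ u v

  -- |E^-(V1,V2)|
  E⁻ : Subset N → Subset N → ℚ
  E⁻ V₁ V₂ = sumFin λ u → sumFin λ v → ind V₁ u * ind V₂ v * isNeg (σ Γ u v) * w Γ u v

  vol : (Fin N → ℚ) → Subset N → ℚ
  vol μ S = sumFin λ u → ind S u * μ u

  -- β^σ(V1,V2); the division is by vol_μ(V1 ∪ V2), which is positive for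
  -- sub-bipartitions when μ is positive (the fallback value 0 is never used there).
  β : (Fin N → ℚ) → Subset N → Subset N → ℚ
  β μ V₁ V₂ with vol μ (V₁ ∪ V₂) ≟ 0ℚ
  ... | yes _ = 0ℚ
  ... | no ne = (((2ℚ' * E⁺ V₁ V₂) + E⁻ V₁ V₁) + E⁻ V₂ V₂ + E (V₁ ∪ V₂) (∁ (V₁ ∪ V₂)))
                  ÷ vol μ (V₁ ∪ V₂)
    where instance _ = ≢-nonZero ne
          2ℚ' : ℚ
          2ℚ' = 1ℚ + 1ℚ

-- a sub-bipartition: disjoint V1, V2 with V1 ∪ V2 nonempty
IsSubBipartition : ∀ {N} → Subset N → Subset N → Set
IsSubBipartition V₁ V₂ = (V₁ ∩ V₂ ≡ ⊥) × Nonempty (V₁ ∪ V₂)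

-- a k-tuple of sub-bipartitions with pairwise disjoint unions
IsAdmissible : ∀ {N} k → (Fin k → Subset N × Subset N) → Set
IsAdmissible k T =
  (∀ i → IsSubBipartition (Data.Product.proj₁ (T i)) (Data.Product.proj₂ (T i))) ×
  (∀ i j → i ≢ j →
     ((Data.Product.proj₁ (T i) ∪ Data.Product.proj₂ (T i)) ∩
      (Data.Product.proj₁ (T j) ∪ Data.Product.proj₂ (T j))) ≡ ⊥)

module _ {N : ℕ} (Γ : SignedGraph N) (μ : Fin N → ℚ) where

  maxβ : ∀ {k} → (Fin k → Subset N × Subset N) → ℚ
  maxβ T = maxFin λ i → β Γ μ (Data.Product.proj₁ (T i)) (Data.Product.proj₂ (T i))

  -- h is the value h^σ_k(μ): the minimum over admissible k-tuples of maxβ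
  IsHk : ℕ → ℚ → Set
  IsHk k h =
    (Σ (Fin k → Subset N × Subset N) λ T → IsAdmissible k T × maxβ T ≡ h) ×
    (∀ (T : Fin k → Subset N × Subset N) → IsAdmissible k T → h ≤ maxβ T)

module _ {N : ℕ} (Γ : SignedGraph N) where

  Adj : Fin N → Fin N → Set
  Adj u v = 0ℚ < w Γ u v

  -- reachability along edges
  data Reach : Fin N → Fin N → Set where
    here : ∀ {u} → Reach u u
    step : ∀ {u v x} → Adj u v → Reach v x → Reach u x

  -- a connected component: a nonempty vertex set equal to the
  -- reachability class of each of its vertices
  IsComponent : Subset N → Set
  IsComponent C = Nonempty C × (∀ u → u ∈ C → ∀ v → (v ∈ C ⇔ Reach u v))

  -- for a list y₁ … yₘ and the start x = y₁: consecutive pairs and the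
  -- closing pair (yₘ , x)
  closedAdj : Fin N → List (Fin N) → Set
  closedAdj x []            = ⊤
  closedAdj x (y ∷ [])      = Adj y x
  closedAdj x (y ∷ z ∷ ys)  = Adj y z × closedAdj x (z ∷ ys)

  closedSign : Fin N → List (Fin N) → Sign
  closedSign x []           = Sign.+
  closedSign x (y ∷ [])     = σ Γ y x
  closedSign x (y ∷ z ∷ ys) = σ Γ y z *ˢ closedSign x (z ∷ ys)

  -- a cycle: distinct vertices x = y₁, …, yₘ (m ≥ 3), consecutive ones adjacent,
  -- and yₘ adjacent to y₁
  IsCycle : List (Fin N) → Set
  IsCycle []       = Data.Empty.⊥
    where import Data.Empty
  IsCycle (x ∷ ys) = (3 Data.Nat.≤ length (x ∷ ys)) × Unique (x ∷ ys) × closedAdj x (x ∷ ys)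

  cycleSign : List (Fin N) → Sign
  cycleSign []       = Sign.+
  cycleSign (x ∷ ys) = closedSign x (x ∷ ys)

  AllIn : Subset N → List (Fin N) → Set
  AllIn C []       = ⊤
  AllIn C (x ∷ xs) = (x ∈ C) × AllIn C xs

  -- balanced: every cycle of the induced subgraph on C is positive
  Balanced : Subset N → Set
  Balanced C = ∀ c → IsCycle c → AllIn C c → cycleSign c ≡ Sign.+

  -- Γ has (at least) k distinct balanced connected components
  HasBalancedComponents : ℕ → Set
  HasBalancedComponents k =
    Σ (Fin k → Subset N) λ C →
      (∀ i → IsComponent (C i) × Balanced (C i)) × (∀ i j → i ≢ j → C i ≢ C j)

{-# OPTIONS --safe #-}
module Submission where

-- β(V₁,V₂) is a sum of nonnegative edge weights over a positive volume, so it vanishes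
-- exactly when (V₁,V₂) is a Harary bipartition of a set without outgoing edges: no
-- positive edge between V₁ and V₂, no negative edge inside V₁ or V₂.  On such a set σ is
-- switched to the all-positive signature by s = + on V₁, − on V₂, so every cycle in it is
-- positive and the component of any of its vertices is balanced; disjoint sets give
-- distinct components.  Conversely, in a balanced component every closed walk is positive
-- (split it at a repeated vertex until it is a cycle), so the sign of a walk from a fixed
-- root does not depend on the walk, and its level sets form a Harary bipartition.

open import Defs
open import Data.Bool using (true; false; if_then_else_)
open import Data.Bool.Properties using (T-≡)
open import Data.Empty using (⊥-elim)
open import Data.Fin using (Fin; zero; suc)
open import Data.Fin.Properties using (any?) renaming (_≟_ to _≟ᶠ_)
open import Data.Fin.Subset using (Subset; _∈_; _∉_; _∪_; _∩_; ∁; ⊥; ⁅_⁆; ∣_∣; _⊆_; Nonempty)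
open import Data.Fin.Subset.Properties
  using ( _∈?_; _⊂?_; x∉p⇒x∈∁p; x∈∁p⇒x∉p; x∈p∪q⁻; x∈p∪q⁺; x∈p∩q⁺; x∈p∩q⁻; ∉⊥; Empty-unique
        ; p⊂q⇒∣p∣<∣q∣; ∣p∣≤n; ∣⁅x⁆∣≡1; x∈⁅x⁆; x∈⁅y⁆⇒x≡y; ⊆-antisym )
open import Data.List using (List; []; _∷_; _++_; length)
open import Data.List.Properties using (∷-injective; length-++)
open import Data.List.Membership.DecPropositional using () renaming (_∈?_ to _∈ˡ?_)
open import Data.List.Membership.Propositional.Properties using (∈-∃++)
open import Data.List.Relation.Unary.All.Properties using (¬Any⇒All¬)
open import Data.List.Relation.Unary.Unique.Propositional using (Unique; []; _∷_)
open import Data.Nat as ℕ using (ℕ; zero; suc; _≤_; s≤s; z≤n)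
import Data.Nat.Properties as ℕₚ
open import Data.Nat.Induction using (<-wellFounded)
open import Data.Product using (Σ; ∃; ∃₂; _×_; _,_; proj₁; proj₂)
open import Data.Product.Function.NonDependent.Propositional using (_×-⇔_)
open import Data.Rational as ℚ
  using (ℚ; 0ℚ; 1ℚ; _+_; _*_; _÷_; _⊔_; NonZero; 1/_; positive; ≢-nonZero)
open import Data.Rational.Properties
  using ( ≤-refl; ≤-trans; ≤-antisym; <-irrefl; <-≤-trans; <⇒≤; ≮⇒≥; _<?_; _≟_
        ; +-mono-≤; +-monoˡ-≤; +-monoʳ-≤; +-identityˡ; +-identityʳ
        ; *-zeroˡ; *-identityˡ; *-identityʳ; *-assoc; *-distribʳ-+; *-inverseˡ; *-monoʳ-≤-nonNeg
        ; p≤p⊔q; p≤q⊔p; pos⇒nonNeg; pos⇒nonZero; 1/pos⇒pos )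
open import Data.Sign using (Sign; opposite) renaming (_*_ to _*ˢ_)
import Data.Sign.Properties as Signₚ
open import Data.Sum using (_⊎_; inj₁; inj₂)
open import Data.Unit using (⊤; tt)
open import Data.Vec using (lookup; tabulate)
open import Data.Vec.Properties using (lookup∘tabulate; []=⇒lookup; lookup⇒[]=)
open import Function using (_∘_; case_of_)
open import Function.Bundles using (_⇔_; mk⇔; Equivalence)
open import Function.Construct.Composition using (_⇔-∘_)
open import Induction.WellFounded using (Acc; acc)
open import Relation.Binary.Definitions using (DecidableEquality)
open import Relation.Binary.PropositionalEquality
open import Relation.Nullary using (¬_; Dec; yes; no)
open import Relation.Nullary.Decidable using (_×-dec_; _⊎-dec_; isYes; toWitness; fromWitness)
open import Relation.Unary using (Decidable)

open Equivalence using (to; from)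

-- Nonnegative rationals
+-nonneg≡0⇔ : ∀ {p q} → 0ℚ ℚ.≤ p → 0ℚ ℚ.≤ q → p + q ≡ 0ℚ ⇔ (p ≡ 0ℚ × q ≡ 0ℚ)
+-nonneg≡0⇔ {p} {q} 0≤p 0≤q = mk⇔
  (λ p+q≡0 → ≤-antisym (subst (p ℚ.≤_) p+q≡0 p≤p+q) 0≤p , ≤-antisym (subst (q ℚ.≤_) p+q≡0 q≤p+q) 0≤q)
  (λ { (refl , refl) → refl })
  where
  p≤p+q : p ℚ.≤ p + q
  p≤p+q = subst (ℚ._≤ p + q) (+-identityʳ p) (+-monoʳ-≤ p 0≤q)
  q≤p+q : q ℚ.≤ p + q
  q≤p+q = subst (ℚ._≤ p + q) (+-identityˡ q) (+-monoˡ-≤ q 0≤p)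

[1+1]*p≡p+p : ∀ p → (1ℚ + 1ℚ) * p ≡ p + p
[1+1]*p≡p+p p = trans (*-distribʳ-+ p 1ℚ 1ℚ) (cong₂ _+_ (*-identityˡ p) (*-identityˡ p))

double-nonneg : ∀ {p} → 0ℚ ℚ.≤ p → 0ℚ ℚ.≤ (1ℚ + 1ℚ) * p
double-nonneg {p} 0≤p = subst (0ℚ ℚ.≤_) (sym ([1+1]*p≡p+p p)) (+-mono-≤ 0≤p 0≤p)

double≡0⇔ : ∀ {p} → 0ℚ ℚ.≤ p → (1ℚ + 1ℚ) * p ≡ 0ℚ ⇔ p ≡ 0ℚ
double≡0⇔ {p} 0≤p = mk⇔
  (λ 2p≡0 → proj₁ (to (+-nonneg≡0⇔ 0≤p 0≤p) (trans (sym ([1+1]*p≡p+p p)) 2p≡0)))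
  (λ { refl → refl })

÷-nonneg : ∀ {p q} .{{_ : NonZero q}} → 0ℚ ℚ.≤ p → 0ℚ ℚ.< q → 0ℚ ℚ.≤ p ÷ q
÷-nonneg {p} {q} 0≤p 0<q =
  subst (ℚ._≤ p * 1/q) (*-zeroˡ 1/q) (*-monoʳ-≤-nonNeg 1/q {{pos⇒nonNeg 1/q {{1/pos⇒pos q}}}} 0≤p)
  where
  instance _ = positive 0<q
  -- 1/ q built with the NonZero instance that 1/pos⇒pos is stated for; instance search cannot unify it with the given one
  1/q : ℚ
  1/q = (1/ q) {{pos⇒nonZero q}}

÷≡0⇔ : ∀ {p q} .{{_ : NonZero q}} → p ÷ q ≡ 0ℚ ⇔ p ≡ 0ℚ
÷≡0⇔ {p} {q} = mk⇔ p÷q≡0⇒p≡0 (λ { refl → *-zeroˡ (1/ q) })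
  where
  open ≡-Reasoning
  p÷q≡0⇒p≡0 : p ÷ q ≡ 0ℚ → p ≡ 0ℚ
  p÷q≡0⇒p≡0 p÷q≡0 = begin
    p              ≡⟨ *-identityʳ p ⟨
    p * 1ℚ         ≡⟨ cong (p *_) (*-inverseˡ q) ⟨
    p * (1/ q * q) ≡⟨ *-assoc p (1/ q) q ⟨
    p ÷ q * q      ≡⟨ cong (_* q) p÷q≡0 ⟩
    0ℚ * q         ≡⟨ *-zeroˡ q ⟩
    0ℚ             ∎

sumFin-nonneg : ∀ {n} (f : Fin n → ℚ) → (∀ i → 0ℚ ℚ.≤ f i) → 0ℚ ℚ.≤ sumFin f
sumFin-nonneg {zero}  f f≥0 = ≤-refl
sumFin-nonneg {suc n} f f≥0 = +-mono-≤ (f≥0 zero) (sumFin-nonneg (f ∘ suc) (f≥0 ∘ suc))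

sumFin-nonneg≡0⇔ : ∀ {n} (f : Fin n → ℚ) → (∀ i → 0ℚ ℚ.≤ f i) → sumFin f ≡ 0ℚ ⇔ (∀ i → f i ≡ 0ℚ)
sumFin-nonneg≡0⇔ {zero}  f f≥0 = mk⇔ (λ _ ()) (λ _ → refl)
sumFin-nonneg≡0⇔ {suc n} f f≥0 = mk⇔
  (λ sum≡0 → let (head≡0 , tail≡0) = to split sum≡0 in
     λ { zero → head≡0 ; (suc i) → to tail tail≡0 i })
  (λ f≡0 → from split (f≡0 zero , from tail (f≡0 ∘ suc)))
  where
  split = +-nonneg≡0⇔ (f≥0 zero) (sumFin-nonneg (f ∘ suc) (f≥0 ∘ suc))
  tail = sumFin-nonneg≡0⇔ (f ∘ suc) (f≥0 ∘ suc)

term≤sumFin : ∀ {n} (f : Fin n → ℚ) → (∀ i → 0ℚ ℚ.≤ f i) → ∀ i → f i ℚ.≤ sumFin f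
term≤sumFin {suc n} f f≥0 zero =
  subst (ℚ._≤ sumFin f) (+-identityʳ (f zero)) (+-monoʳ-≤ (f zero) (sumFin-nonneg (f ∘ suc) (f≥0 ∘ suc)))
term≤sumFin {suc n} f f≥0 (suc i) =
  ≤-trans (term≤sumFin (f ∘ suc) (f≥0 ∘ suc) i)
          (subst (ℚ._≤ sumFin f) (+-identityˡ _) (+-monoˡ-≤ (sumFin (f ∘ suc)) (f≥0 zero)))

term≤maxFin : ∀ {n} (f : Fin n → ℚ) i → f i ℚ.≤ maxFin f
term≤maxFin {suc zero}    f zero    = ≤-refl
term≤maxFin {suc (suc n)} f zero    = p≤p⊔q (f zero) _
term≤maxFin {suc (suc n)} f (suc i) = ≤-trans (term≤maxFin (f ∘ suc) i) (p≤q⊔p (f zero) _)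

maxFin-zero : ∀ {n} (f : Fin n → ℚ) → (∀ i → f i ≡ 0ℚ) → maxFin f ≡ 0ℚ
maxFin-zero {zero}        f f≡0 = refl
maxFin-zero {suc zero}    f f≡0 = f≡0 zero
maxFin-zero {suc (suc n)} f f≡0 = cong₂ _⊔_ (f≡0 zero) (maxFin-zero (f ∘ suc) (f≡0 ∘ suc))

IsBit : ℚ → Set
IsBit p = p ≡ 0ℚ ⊎ p ≡ 1ℚ

bit-* : ∀ {p q} → IsBit p → IsBit q → IsBit (p * q)
bit-* (inj₁ refl) (inj₁ refl) = inj₁ refl
bit-* (inj₁ refl) (inj₂ refl) = inj₁ refl
bit-* (inj₂ refl) (inj₁ refl) = inj₁ refl
bit-* (inj₂ refl) (inj₂ refl) = inj₂ refl

bit-*≡1⇔ : ∀ {p q} → IsBit p → IsBit q → p * q ≡ 1ℚ ⇔ (p ≡ 1ℚ × q ≡ 1ℚ)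
bit-*≡1⇔ (inj₁ refl) (inj₁ refl) = mk⇔ (λ ()) (λ ())
bit-*≡1⇔ (inj₁ refl) (inj₂ refl) = mk⇔ (λ ()) (λ ())
bit-*≡1⇔ (inj₂ refl) (inj₁ refl) = mk⇔ (λ ()) (λ ())
bit-*≡1⇔ (inj₂ refl) (inj₂ refl) = mk⇔ (λ _ → refl , refl) (λ _ → refl)

bit-*-nonneg : ∀ {p q} → IsBit p → 0ℚ ℚ.≤ q → 0ℚ ℚ.≤ p * q
bit-*-nonneg {q = q} (inj₁ refl) _   = subst (0ℚ ℚ.≤_) (sym (*-zeroˡ q)) ≤-refl
bit-*-nonneg {q = q} (inj₂ refl) 0≤q = subst (0ℚ ℚ.≤_) (sym (*-identityˡ q)) 0≤q

bit-*≡0⇔ : ∀ {p q} → IsBit p → p * q ≡ 0ℚ ⇔ (p ≡ 1ℚ → q ≡ 0ℚ)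
bit-*≡0⇔ {q = q} (inj₁ refl) = mk⇔ (λ _ ()) (λ _ → *-zeroˡ q)
bit-*≡0⇔ {q = q} (inj₂ refl) = mk⇔ (λ e _ → trans (sym (*-identityˡ q)) e) (λ h → trans (*-identityˡ q) (h refl))

ind-bit : ∀ {n} (S : Subset n) u → IsBit (ind S u)
ind-bit S u with lookup S u
... | true  = inj₂ refl
... | false = inj₁ refl

ind≡1⇔ : ∀ {n} {S : Subset n} {u} → ind S u ≡ 1ℚ ⇔ u ∈ S
ind≡1⇔ {S = S} {u} = mk⇔ ind≡1⇒∈ (λ u∈S → cong (λ b → if b then 1ℚ else 0ℚ) ([]=⇒lookup u∈S))
  where
  ind≡1⇒∈ : ind S u ≡ 1ℚ → u ∈ S
  ind≡1⇒∈ ind≡1 with lookup S u in lookup≡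
  ... | true  = lookup⇒[]= u S lookup≡
  ... | false = case ind≡1 of λ ()

ind*ind-bit : ∀ {n} (A B : Subset n) u v → IsBit (ind A u * ind B v)
ind*ind-bit A B u v = bit-* (ind-bit A u) (ind-bit B v)

ind*ind≡1⇔ : ∀ {n} {A B : Subset n} {u v} → ind A u * ind B v ≡ 1ℚ ⇔ (u ∈ A × v ∈ B)
ind*ind≡1⇔ {A = A} {B} {u} {v} = (ind≡1⇔ ×-⇔ ind≡1⇔) ⇔-∘ bit-*≡1⇔ (ind-bit A u) (ind-bit B v)

isPos-bit : ∀ s → IsBit (isPos s)
isPos-bit Sign.+ = inj₂ refl
isPos-bit Sign.- = inj₁ refl

isNeg-bit : ∀ s → IsBit (isNeg s)
isNeg-bit Sign.+ = inj₁ refl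
isNeg-bit Sign.- = inj₂ refl

isPos≡1⇔ : ∀ {s} → isPos s ≡ 1ℚ ⇔ s ≡ Sign.+
isPos≡1⇔ {Sign.+} = mk⇔ (λ _ → refl) (λ _ → refl)
isPos≡1⇔ {Sign.-} = mk⇔ (λ ()) (λ ())

isNeg≡1⇔ : ∀ {s} → isNeg s ≡ 1ℚ ⇔ s ≡ Sign.-
isNeg≡1⇔ {Sign.+} = mk⇔ (λ ()) (λ ())
isNeg≡1⇔ {Sign.-} = mk⇔ (λ _ → refl) (λ _ → refl)

-- Subsets, signs and lists
decSubset : ∀ {n} {P : Fin n → Set} → Decidable P → Subset n
decSubset P? = tabulate (isYes ∘ P?)

∈-decSubset⇔ : ∀ {n} {P : Fin n → Set} (P? : Decidable P) {x} → x ∈ decSubset P? ⇔ P x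
∈-decSubset⇔ P? {x} = mk⇔
  (λ x∈ → toWitness (from T-≡ (trans (sym (lookup∘tabulate (isYes ∘ P?) x)) ([]=⇒lookup x∈))))
  (λ px → lookup⇒[]= x _ (trans (lookup∘tabulate (isYes ∘ P?) x) (to T-≡ (fromWitness px))))

*ˢ-cancel-middle : ∀ a b c → (a *ˢ b) *ˢ (b *ˢ c) ≡ a *ˢ c
*ˢ-cancel-middle Sign.+ Sign.+ c = refl
*ˢ-cancel-middle Sign.+ Sign.- c = Signₚ.opposite-involutive c
*ˢ-cancel-middle Sign.- Sign.+ c = refl
*ˢ-cancel-middle Sign.- Sign.- c = refl

*ˢ-isolate-middle : ∀ a t b → a *ˢ (t *ˢ b) ≡ Sign.+ → t ≡ a *ˢ b
*ˢ-isolate-middle Sign.+ Sign.+ Sign.+ _ = refl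
*ˢ-isolate-middle Sign.+ Sign.- Sign.- _ = refl
*ˢ-isolate-middle Sign.- Sign.+ Sign.- _ = refl
*ˢ-isolate-middle Sign.- Sign.- Sign.+ _ = refl
*ˢ-isolate-middle Sign.+ Sign.+ Sign.- ()
*ˢ-isolate-middle Sign.+ Sign.- Sign.+ ()
*ˢ-isolate-middle Sign.- Sign.+ Sign.+ ()
*ˢ-isolate-middle Sign.- Sign.- Sign.- ()

≡⊎≡opposite : ∀ t s → t ≡ s ⊎ t ≡ opposite s
≡⊎≡opposite Sign.+ Sign.+ = inj₁ refl
≡⊎≡opposite Sign.+ Sign.- = inj₂ refl
≡⊎≡opposite Sign.- Sign.+ = inj₂ refl
≡⊎≡opposite Sign.- Sign.- = inj₁ refl

record Repetition {A : Set} (xs : List A) : Set where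
  constructor repetition
  field
    before   : List A
    repeated : A
    between  : List A
    after    : List A
    split    : xs ≡ before ++ repeated ∷ between ++ repeated ∷ after

unique⊎repetition : ∀ {A : Set} → DecidableEquality A → (xs : List A) → Unique xs ⊎ Repetition xs
unique⊎repetition _≟_ []       = inj₁ []
unique⊎repetition _≟_ (x ∷ xs) with _∈ˡ?_ _≟_ x xs
... | yes x∈xs = let (b , c , eq) = ∈-∃++ x∈xs in inj₂ (repetition [] x b c (cong (x ∷_) eq))
... | no x∉xs with unique⊎repetition _≟_ xs
...   | inj₁ unique                   = inj₁ (¬Any⇒All¬ xs x∉xs ∷ unique)
...   | inj₂ (repetition a p b c eq) = inj₂ (repetition (x ∷ a) p b c (cong (x ∷_) eq))

module _ {N : ℕ} (Γ : SignedGraph N) where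

  private
    variable
      u v x y : Fin N
      V₁ V₂ : Subset N

  -- Walks
  Adj? : ∀ u v → Dec (Adj Γ u v)
  Adj? u v = 0ℚ <? w Γ u v

  Adj-sym : Adj Γ u v → Adj Γ v u
  Adj-sym {u} {v} = subst (0ℚ ℚ.<_) (w-sym Γ u v)

  ¬Adj-loop : ¬ Adj Γ u u
  ¬Adj-loop {u} a = <-irrefl refl (subst (0ℚ ℚ.<_) (w-loop Γ u) a)

  infixr 5 _◅◅_
  _◅◅_ : Reach Γ u v → Reach Γ v x → Reach Γ u x
  here     ◅◅ q = q
  step a p ◅◅ q = step a (p ◅◅ q)

  _▻_ : Reach Γ u v → Adj Γ v x → Reach Γ u x
  p ▻ a = p ◅◅ step a here

  reverse : Reach Γ u v → Reach Γ v u
  reverse here       = here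
  reverse (step a p) = reverse p ▻ Adj-sym a

  sign : Reach Γ u v → Sign
  sign here               = Sign.+
  sign (step {u} {v} _ p) = σ Γ u v *ˢ sign p

  sign-◅◅ : (p : Reach Γ u v) (q : Reach Γ v x) → sign (p ◅◅ q) ≡ sign p *ˢ sign q
  sign-◅◅ here               q = sym (Signₚ.*-identityˡ (sign q))
  sign-◅◅ (step {u} {v} _ p) q =
    trans (cong (σ Γ u v *ˢ_) (sign-◅◅ p q)) (sym (Signₚ.*-assoc (σ Γ u v) (sign p) (sign q)))

  sign-reverse : (p : Reach Γ u v) → sign (reverse p) ≡ sign p
  sign-reverse here = refl
  sign-reverse (step {u} {v} a p) = begin
    sign (reverse p ▻ Adj-sym a)            ≡⟨ sign-◅◅ (reverse p) (step (Adj-sym a) here) ⟩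
    sign (reverse p) *ˢ (σ Γ v u *ˢ Sign.+) ≡⟨ cong₂ _*ˢ_ (sign-reverse p) (Signₚ.*-identityʳ (σ Γ v u)) ⟩
    sign p *ˢ σ Γ v u                       ≡⟨ cong (sign p *ˢ_) (σ-sym Γ v u) ⟩
    sign p *ˢ σ Γ u v                       ≡⟨ Signₚ.*-comm (sign p) (σ Γ u v) ⟩
    σ Γ u v *ˢ sign p                       ∎
    where open ≡-Reasoning

  -- all vertices of the walk except its last one
  vertices : Reach Γ u v → List (Fin N)
  vertices here           = []
  vertices (step {u} _ p) = u ∷ vertices p

  vertices-◅◅ : (p : Reach Γ u v) (q : Reach Γ v x) → vertices (p ◅◅ q) ≡ vertices p ++ vertices q
  vertices-◅◅ here       q = refl
  vertices-◅◅ (step a p) q = cong (_ ∷_) (vertices-◅◅ p q)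

  walkLength : Reach Γ u v → ℕ
  walkLength p = length (vertices p)

  walkLength-◅◅ : (p : Reach Γ u v) (q : Reach Γ v x) → walkLength (p ◅◅ q) ≡ walkLength p ℕ.+ walkLength q
  walkLength-◅◅ p q = trans (cong length (vertices-◅◅ p q)) (length-++ (vertices p))

  splitAt : ∀ {p rest} (w : Reach Γ u v) pre → vertices w ≡ pre ++ p ∷ rest →
            ∃₂ λ (w₁ : Reach Γ u p) (w₂ : Reach Γ p v) →
              w ≡ w₁ ◅◅ w₂ × vertices w₁ ≡ pre × vertices w₂ ≡ p ∷ rest
  splitAt here       []        ()
  splitAt here       (_ ∷ _)   ()
  splitAt (step a w) []        eq with ∷-injective eq
  ... | refl , _ = here , step a w , refl , refl , eq
  splitAt (step a w) (_ ∷ pre) eq with ∷-injective eq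
  ... | refl , eq′ with splitAt w pre eq′
  ...   | w₁ , w₂ , refl , eq₁ , eq₂ = step a w₁ , w₂ , refl , cong (_ ∷_) eq₁ , eq₂

  closedAdj-vertices : (w : Reach Γ y x) → closedAdj Γ x (vertices w)
  closedAdj-vertices here                  = tt
  closedAdj-vertices (step a here)         = a
  closedAdj-vertices (step a w@(step _ _)) = a , closedAdj-vertices w

  closedSign-vertices : (w : Reach Γ y x) → closedSign Γ x (vertices w) ≡ sign w
  closedSign-vertices here                  = refl
  closedSign-vertices (step a here)         = sym (Signₚ.*-identityʳ _)
  closedSign-vertices (step a w@(step _ _)) = cong (σ Γ _ _ *ˢ_) (closedSign-vertices w)

  Closed : Subset N → Set
  Closed C = ∀ {x y} → x ∈ C → Adj Γ x y → y ∈ C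

  Closed-Reach : ∀ {C} → Closed C → u ∈ C → Reach Γ u v → v ∈ C
  Closed-Reach closed u∈C here       = u∈C
  Closed-Reach closed u∈C (step a p) = Closed-Reach closed (closed u∈C a) p

  AllIn-vertices : ∀ {C} → Closed C → u ∈ C → (w : Reach Γ u v) → AllIn Γ C (vertices w)
  AllIn-vertices closed u∈C here       = tt
  AllIn-vertices closed u∈C (step a w) = u∈C , AllIn-vertices closed (closed u∈C a) w

  module _ {C : Subset N} (closed : Closed C) (balanced : Balanced Γ C) where

    uniqueClosedWalk-positive : u ∈ C → (w : Reach Γ u u) → Unique (vertices w) → sign w ≡ Sign.+
    uniqueClosedWalk-positive u∈C here _ = refl
    uniqueClosedWalk-positive u∈C (step a here) _ = ⊥-elim (¬Adj-loop a)
    uniqueClosedWalk-positive u∈C (step {u} {v} a (step b here)) _ = begin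
      σ Γ u v *ˢ (σ Γ v u *ˢ Sign.+) ≡⟨ cong (σ Γ u v *ˢ_) (trans (Signₚ.*-identityʳ _) (σ-sym Γ v u)) ⟩
      σ Γ u v *ˢ σ Γ u v            ≡⟨ Signₚ.s*s≡+ (σ Γ u v) ⟩
      Sign.+                        ∎
      where open ≡-Reasoning
    uniqueClosedWalk-positive u∈C w@(step _ (step _ (step _ _))) unique =
      trans (sym (closedSign-vertices w))
            (balanced (vertices w) (s≤s (s≤s (s≤s z≤n)) , unique , closedAdj-vertices w)
                      (AllIn-vertices closed u∈C w))

    -- At a repeated vertex p, w = w₁ ◅◅ w₃ ◅◅ w₄ with w₃ closed at p; w₃ and w₁ ◅◅ w₄ are shorter.
    closedWalk-positive : u ∈ C → (w : Reach Γ u u) → sign w ≡ Sign.+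
    closedWalk-positive u∈C w = go u∈C w (<-wellFounded (walkLength w))
      where
      go : ∀ {u} → u ∈ C → (w : Reach Γ u u) → Acc ℕ._<_ (walkLength w) → sign w ≡ Sign.+
      go u∈C w (acc shorter) with unique⊎repetition _≟ᶠ_ (vertices w)
      ... | inj₁ unique = uniqueClosedWalk-positive u∈C w unique
      ... | inj₂ (repetition a p b c eq) with splitAt w a eq
      ... | w₁ , w₂ , refl , _ , eq₂ with splitAt w₂ (p ∷ b) eq₂
      ... | w₃ , w₄ , refl , eq₃ , eq₄ = begin
        sign (w₁ ◅◅ w₃ ◅◅ w₄)           ≡⟨ trans (sign-◅◅ w₁ (w₃ ◅◅ w₄)) (cong (sign w₁ *ˢ_) (sign-◅◅ w₃ w₄)) ⟩
        sign w₁ *ˢ (sign w₃ *ˢ sign w₄) ≡⟨ cong (λ s → sign w₁ *ˢ (s *ˢ sign w₄)) (go p∈C w₃ (shorter inner<)) ⟩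
        sign w₁ *ˢ sign w₄              ≡⟨ sign-◅◅ w₁ w₄ ⟨
        sign (w₁ ◅◅ w₄)                 ≡⟨ go u∈C (w₁ ◅◅ w₄) (shorter outer<) ⟩
        Sign.+                          ∎
        where
        open ≡-Reasoning
        p∈C : p ∈ C
        p∈C = Closed-Reach closed u∈C w₁
        len₃>0 : 0 ℕ.< walkLength w₃
        len₃>0 = subst (λ vs → 0 ℕ.< length vs) (sym eq₃) (s≤s z≤n)
        len₄>0 : 0 ℕ.< walkLength w₄
        len₄>0 = subst (λ vs → 0 ℕ.< length vs) (sym eq₄) (s≤s z≤n)
        length-split : walkLength (w₁ ◅◅ w₃ ◅◅ w₄) ≡ walkLength w₁ ℕ.+ (walkLength w₃ ℕ.+ walkLength w₄)
        length-split = trans (walkLength-◅◅ w₁ (w₃ ◅◅ w₄)) (cong (walkLength w₁ ℕ.+_) (walkLength-◅◅ w₃ w₄))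
        inner< : walkLength w₃ ℕ.< walkLength (w₁ ◅◅ w₃ ◅◅ w₄)
        inner< = subst (walkLength w₃ ℕ.<_) (sym length-split)
                   (ℕₚ.<-≤-trans (ℕₚ.m<m+n _ len₄>0) (ℕₚ.m≤n+m _ (walkLength w₁)))
        outer< : walkLength (w₁ ◅◅ w₄) ℕ.< walkLength (w₁ ◅◅ w₃ ◅◅ w₄)
        outer< = subst₂ ℕ._<_ (sym (walkLength-◅◅ w₁ w₄)) (sym length-split)
                   (ℕₚ.+-monoʳ-< (walkLength w₁) (ℕₚ.m<n+m _ len₃>0))

  -- Connected components
  expand : Subset N → Subset N
  expand S = decSubset (λ y → (y ∈? S) ⊎-dec any? (λ x → (x ∈? S) ×-dec Adj? x y))

  ∈-expand⇔ : ∀ {S} → y ∈ expand S ⇔ (y ∈ S ⊎ ∃ λ x → x ∈ S × Adj Γ x y)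
  ∈-expand⇔ = ∈-decSubset⇔ _

  ⊆-expand : ∀ {S} → S ⊆ expand S
  ⊆-expand y∈S = from ∈-expand⇔ (inj₁ y∈S)

  Closed-expand : ∀ {S} → Closed S → Closed (expand S)
  Closed-expand {S} closed y∈ a = ⊆-expand (closed (expand⊆ y∈) a)
    where
    expand⊆ : expand S ⊆ S
    expand⊆ y∈ with to ∈-expand⇔ y∈
    ... | inj₁ y∈S           = y∈S
    ... | inj₂ (_ , x∈S , a) = closed x∈S a

  Closed⊎expand-grows : ∀ S → Closed S ⊎ ∣ S ∣ ℕ.< ∣ expand S ∣
  Closed⊎expand-grows S with S ⊂? expand S
  ... | yes S⊂ = inj₂ (p⊂q⇒∣p∣<∣q∣ S⊂)
  ... | no S⊄  = inj₁ closed
    where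
    closed : Closed S
    closed {x} {y} x∈S a with y ∈? S
    ... | yes y∈S = y∈S
    ... | no y∉S  = ⊥-elim (S⊄ (⊆-expand , y , from ∈-expand⇔ (inj₂ (x , x∈S , a)) , y∉S))

  ball : Fin N → ℕ → Subset N
  ball u zero    = ⁅ u ⁆
  ball u (suc n) = expand (ball u n)

  ∈-ball : ∀ u n → u ∈ ball u n
  ∈-ball u zero    = x∈⁅x⁆ u
  ∈-ball u (suc n) = ⊆-expand (∈-ball u n)

  ball-Reach : ∀ n → v ∈ ball u n → Reach Γ u v
  ball-Reach {u = u} zero v∈ rewrite x∈⁅y⁆⇒x≡y u v∈ = here
  ball-Reach (suc n) v∈ with to ∈-expand⇔ v∈
  ... | inj₁ v∈ball           = ball-Reach n v∈ball
  ... | inj₂ (_ , x∈ball , a) = ball-Reach n x∈ball ▻ a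

  ball-Closed⊎large : ∀ u n → Closed (ball u n) ⊎ n ℕ.< ∣ ball u n ∣
  ball-Closed⊎large u zero = inj₂ (subst (0 ℕ.<_) (sym (∣⁅x⁆∣≡1 u)) (s≤s z≤n))
  ball-Closed⊎large u (suc n) with ball-Closed⊎large u n | Closed⊎expand-grows (ball u n)
  ... | inj₁ closed | _           = inj₁ (Closed-expand closed)
  ... | inj₂ _      | inj₁ closed = inj₁ (Closed-expand closed)
  ... | inj₂ large  | inj₂ grows  = inj₂ (ℕₚ.≤-trans (s≤s large) grows)

  component : Fin N → Subset N
  component u = ball u N

  Closed-component : ∀ u → Closed (component u)
  Closed-component u with ball-Closed⊎large u N
  ... | inj₁ closed = closed
  ... | inj₂ large  = ⊥-elim (ℕₚ.<⇒≱ large (∣p∣≤n (ball u N)))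

  ∈-component⇔ : v ∈ component u ⇔ Reach Γ u v
  ∈-component⇔ {u = u} = mk⇔ (ball-Reach N) (Closed-Reach (Closed-component u) (∈-ball u N))

  component-isComponent : ∀ u → IsComponent Γ (component u)
  component-isComponent u = (u , ∈-ball u N) , λ x x∈ v → mk⇔
    (λ v∈ → reverse (to ∈-component⇔ x∈) ◅◅ to ∈-component⇔ v∈)
    (λ x⇝v → from ∈-component⇔ (to ∈-component⇔ x∈ ◅◅ x⇝v))

  IsComponent⇒Closed : ∀ {C} → IsComponent Γ C → Closed C
  IsComponent⇒Closed ((r , r∈C) , reach) x∈C a = from (reach r r∈C _) (to (reach r r∈C _) x∈C ▻ a)

  IsComponent-≡ : ∀ {C D} → IsComponent Γ C → IsComponent Γ D → x ∈ C → x ∈ D → C ≡ D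
  IsComponent-≡ {x = x} (_ , reachC) (_ , reachD) x∈C x∈D = ⊆-antisym
    (λ v∈C → from (reachD x x∈D _) (to (reachC x x∈C _) v∈C))
    (λ v∈D → from (reachC x x∈C _) (to (reachD x x∈D _) v∈D))

  -- Switching functions and Harary bipartitions
  IsSwitching : Subset N → (Fin N → Sign) → Set
  IsSwitching C s = ∀ {x y} → x ∈ C → y ∈ C → Adj Γ x y → σ Γ x y ≡ s x *ˢ s y

  closedSign-switching : ∀ {C s} → IsSwitching C s → x ∈ C → ∀ y ys → AllIn Γ C (y ∷ ys) →
                         closedAdj Γ x (y ∷ ys) → closedSign Γ x (y ∷ ys) ≡ s y *ˢ s x
  closedSign-switching switching x∈C y []       (y∈C , _) a = switching y∈C x∈C a
  closedSign-switching {x = x} {s = s} switching x∈C y (z ∷ zs) (y∈C , zs∈C) (a , as) = begin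
    σ Γ y z *ˢ closedSign Γ x (z ∷ zs) ≡⟨ cong₂ _*ˢ_ (switching y∈C (proj₁ zs∈C) a)
                                                     (closedSign-switching {s = s} switching x∈C z zs zs∈C as) ⟩
    (s y *ˢ s z) *ˢ (s z *ˢ s x)       ≡⟨ *ˢ-cancel-middle (s y) (s z) (s x) ⟩
    s y *ˢ s x                         ∎
    where open ≡-Reasoning

  switching⇒Balanced : ∀ {C s} → IsSwitching C s → Balanced Γ C
  switching⇒Balanced {s = s} switching (x ∷ ys) (_ , _ , closed) (x∈C , ys∈C) =
    trans (closedSign-switching {s = s} switching x∈C x ys (x∈C , ys∈C) closed) (Signₚ.s*s≡+ (s x))

  edge-sign : ∀ {C r} → Closed C → Balanced Γ C → r ∈ C → (p : Reach Γ r x) (q : Reach Γ r y) →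
              Adj Γ x y → σ Γ x y ≡ sign p *ˢ sign q
  edge-sign {x = x} {y} closed balanced r∈C p q a = *ˢ-isolate-middle (sign p) (σ Γ x y) (sign q) (begin
    sign p *ˢ (σ Γ x y *ˢ sign q)       ≡⟨ cong (λ t → sign p *ˢ (σ Γ x y *ˢ t)) (sign-reverse q) ⟨
    sign p *ˢ sign (step a (reverse q)) ≡⟨ sign-◅◅ p (step a (reverse q)) ⟨
    sign (p ◅◅ step a (reverse q))      ≡⟨ closedWalk-positive closed balanced r∈C (p ◅◅ step a (reverse q)) ⟩
    Sign.+                              ∎)
    where open ≡-Reasoning

  balancedComponent-switching : ∀ {C} → IsComponent Γ C → Balanced Γ C → ∃ (IsSwitching C)
  balancedComponent-switching {C} isComponent@((r , r∈C) , reach) balanced = potential , switching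
    where
    walk : x ∈ C → Reach Γ r x
    walk {x} = to (reach r r∈C x)
    potential : Fin N → Sign
    potential x with x ∈? C
    ... | yes x∈C = sign (walk x∈C)
    ... | no _    = Sign.+
    switching : IsSwitching C potential
    switching {x} {y} x∈C y∈C a with x ∈? C | y ∈? C
    ... | yes x∈C′ | yes y∈C′ = edge-sign (IsComponent⇒Closed isComponent) balanced r∈C (walk x∈C′) (walk y∈C′) a
    ... | no x∉C   | _        = ⊥-elim (x∉C x∈C)
    ... | yes _    | no y∉C   = ⊥-elim (y∉C y∈C)

  NoEdges : Subset N → Subset N → (Sign → Set) → Set
  NoEdges A B P = ∀ {u v} → u ∈ A → v ∈ B → P (σ Γ u v) → ¬ Adj Γ u v

  record IsHararyBipartition (V₁ V₂ : Subset N) : Set where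
    field
      no-positive-across  : NoEdges V₁ V₂ (_≡ Sign.+)
      no-negative-within₁ : NoEdges V₁ V₁ (_≡ Sign.-)
      no-negative-within₂ : NoEdges V₂ V₂ (_≡ Sign.-)
      no-boundary         : NoEdges (V₁ ∪ V₂) (∁ (V₁ ∪ V₂)) (λ _ → ⊤)

  edge-sign-forced : ∀ {A B s} → NoEdges A B (_≡ opposite s) → u ∈ A → v ∈ B → Adj Γ u v → σ Γ u v ≡ s
  edge-sign-forced {u = u} {v} {s = s} none u∈A v∈B a with ≡⊎≡opposite (σ Γ u v) s
  ... | inj₁ σ≡s  = σ≡s
  ... | inj₂ σ≡-s = ⊥-elim (none u∈A v∈B σ≡-s a)

  harary-Closed : IsHararyBipartition V₁ V₂ → Closed (V₁ ∪ V₂)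
  harary-Closed {V₁} {V₂} harary {y = y} x∈ a with y ∈? (V₁ ∪ V₂)
  ... | yes y∈ = y∈
  ... | no y∉  = ⊥-elim (IsHararyBipartition.no-boundary harary x∈ (x∉p⇒x∈∁p y∉) tt a)

  hararySign : Subset N → Fin N → Sign
  hararySign V₁ x with x ∈? V₁
  ... | yes _ = Sign.+
  ... | no _  = Sign.-

  hararySign-∈ : x ∈ V₁ → hararySign V₁ x ≡ Sign.+
  hararySign-∈ {x} {V₁} x∈V₁ with x ∈? V₁
  ... | yes _   = refl
  ... | no x∉V₁ = ⊥-elim (x∉V₁ x∈V₁)

  hararySign-∉ : x ∉ V₁ → hararySign V₁ x ≡ Sign.-
  hararySign-∉ {x} {V₁} x∉V₁ with x ∈? V₁
  ... | yes x∈V₁ = ⊥-elim (x∉V₁ x∈V₁)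
  ... | no _     = refl

  disjoint-∉ : V₁ ∩ V₂ ≡ ⊥ → x ∈ V₂ → x ∉ V₁
  disjoint-∉ {x = x} disjoint x∈V₂ x∈V₁ = ∉⊥ (subst (x ∈_) disjoint (x∈p∩q⁺ (x∈V₁ , x∈V₂)))

  harary-switching : IsHararyBipartition V₁ V₂ → V₁ ∩ V₂ ≡ ⊥ → IsSwitching (V₁ ∪ V₂) (hararySign V₁)
  harary-switching {V₁} {V₂} harary disjoint {x} {y} x∈ y∈ a = by-parts (x∈p∪q⁻ V₁ V₂ x∈) (x∈p∪q⁻ V₁ V₂ y∈)
    where
    open IsHararyBipartition harary
    by-parts : x ∈ V₁ ⊎ x ∈ V₂ → y ∈ V₁ ⊎ y ∈ V₂ → σ Γ x y ≡ hararySign V₁ x *ˢ hararySign V₁ y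
    by-parts (inj₁ x∈V₁) (inj₁ y∈V₁) = trans (edge-sign-forced no-negative-within₁ x∈V₁ y∈V₁ a)
      (sym (cong₂ _*ˢ_ (hararySign-∈ x∈V₁) (hararySign-∈ y∈V₁)))
    by-parts (inj₁ x∈V₁) (inj₂ y∈V₂) = trans (edge-sign-forced no-positive-across x∈V₁ y∈V₂ a)
      (sym (cong₂ _*ˢ_ (hararySign-∈ x∈V₁) (hararySign-∉ (disjoint-∉ disjoint y∈V₂))))
    by-parts (inj₂ x∈V₂) (inj₁ y∈V₁) = trans (trans (σ-sym Γ x y) (edge-sign-forced no-positive-across y∈V₁ x∈V₂ (Adj-sym a)))
      (sym (cong₂ _*ˢ_ (hararySign-∉ (disjoint-∉ disjoint x∈V₂)) (hararySign-∈ y∈V₁)))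
    by-parts (inj₂ x∈V₂) (inj₂ y∈V₂) = trans (edge-sign-forced no-negative-within₂ x∈V₂ y∈V₂ a)
      (sym (cong₂ _*ˢ_ (hararySign-∉ (disjoint-∉ disjoint x∈V₂)) (hararySign-∉ (disjoint-∉ disjoint y∈V₂))))

  signPart : Subset N → (Fin N → Sign) → Sign → Subset N
  signPart C s t = decSubset (λ x → (x ∈? C) ×-dec (s x Signₚ.≟ t))

  module _ {C : Subset N} {s : Fin N → Sign} where

    ∈-signPart⇔ : ∀ {t} → x ∈ signPart C s t ⇔ (x ∈ C × s x ≡ t)
    ∈-signPart⇔ = ∈-decSubset⇔ _

    signParts-disjoint : signPart C s Sign.+ ∩ signPart C s Sign.- ≡ ⊥
    signParts-disjoint = Empty-unique λ (x , x∈) →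
      let (x∈₊ , x∈₋) = x∈p∩q⁻ _ _ x∈ in
      case trans (sym (proj₂ (to ∈-signPart⇔ x∈₊))) (proj₂ (to ∈-signPart⇔ x∈₋)) of λ ()

    ∈-signParts⇔ : x ∈ signPart C s Sign.+ ∪ signPart C s Sign.- ⇔ x ∈ C
    ∈-signParts⇔ {x} = mk⇔ ∈parts⇒∈C ∈C⇒∈parts
      where
      ∈parts⇒∈C : x ∈ signPart C s Sign.+ ∪ signPart C s Sign.- → x ∈ C
      ∈parts⇒∈C x∈ with x∈p∪q⁻ _ _ x∈
      ... | inj₁ x∈₊ = proj₁ (to ∈-signPart⇔ x∈₊)
      ... | inj₂ x∈₋ = proj₁ (to ∈-signPart⇔ x∈₋)
      ∈C⇒∈parts : x ∈ C → x ∈ signPart C s Sign.+ ∪ signPart C s Sign.-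
      ∈C⇒∈parts x∈C with ≡⊎≡opposite (s x) Sign.+
      ... | inj₁ sx≡+ = x∈p∪q⁺ (inj₁ (from ∈-signPart⇔ (x∈C , sx≡+)))
      ... | inj₂ sx≡- = x∈p∪q⁺ (inj₂ (from ∈-signPart⇔ (x∈C , sx≡-)))

    switching-harary : Closed C → IsSwitching C s →
                       IsHararyBipartition (signPart C s Sign.+) (signPart C s Sign.-)
    switching-harary closed switching = record
      { no-positive-across  = wrong-sign-absent
      ; no-negative-within₁ = wrong-sign-absent
      ; no-negative-within₂ = wrong-sign-absent
      ; no-boundary         = λ u∈ v∉ _ a →
          x∈∁p⇒x∉p v∉ (from ∈-signParts⇔ (closed (to ∈-signParts⇔ u∈) a))
      }
      where
      wrong-sign-absent : ∀ {t₁ t₂} → NoEdges (signPart C s t₁) (signPart C s t₂) (_≡ opposite (t₁ *ˢ t₂))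
      wrong-sign-absent {t₁} {t₂} u∈ v∈ σ≡ a =
        let (u∈C , su≡t₁) = to ∈-signPart⇔ u∈
            (v∈C , sv≡t₂) = to ∈-signPart⇔ v∈
        in Signₚ.s≢opposite[s] (t₁ *ˢ t₂) (trans (sym (trans (switching u∈C v∈C a) (cong₂ _*ˢ_ su≡t₁ sv≡t₂))) σ≡)

  -- The Cheeger ratio β
  w≡0⇔¬Adj : ∀ {u v} → w Γ u v ≡ 0ℚ ⇔ (¬ Adj Γ u v)
  w≡0⇔¬Adj {u} {v} = mk⇔ (λ w≡0 a → <-irrefl (sym w≡0) a) (λ ¬a → ≤-antisym (≮⇒≥ ¬a) (w-nonneg Γ u v))

  module _ (g : Fin N → Fin N → ℚ) (g-bit : ∀ u v → IsBit (g u v)) where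

    private
      term-nonneg : ∀ u v → 0ℚ ℚ.≤ g u v * w Γ u v
      term-nonneg u v = bit-*-nonneg (g-bit u v) (w-nonneg Γ u v)

      term≡0⇔ : ∀ u v → g u v * w Γ u v ≡ 0ℚ ⇔ (g u v ≡ 1ℚ → ¬ Adj Γ u v)
      term≡0⇔ u v = mk⇔ (λ t≡0 g≡1 → to w≡0⇔¬Adj (to (bit-*≡0⇔ (g-bit u v)) t≡0 g≡1))
                        (λ none → from (bit-*≡0⇔ (g-bit u v)) (from w≡0⇔¬Adj ∘ none))

      rows≡0⇔ = sumFin-nonneg≡0⇔ _ λ u → sumFin-nonneg _ (term-nonneg u)
      row≡0⇔ = λ u → sumFin-nonneg≡0⇔ _ (term-nonneg u)

    weight-nonneg : 0ℚ ℚ.≤ sumFin λ u → sumFin λ v → g u v * w Γ u v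
    weight-nonneg = sumFin-nonneg _ λ u → sumFin-nonneg _ (term-nonneg u)

    weight≡0⇔ : (sumFin λ u → sumFin λ v → g u v * w Γ u v) ≡ 0ℚ ⇔ (∀ u v → g u v ≡ 1ℚ → ¬ Adj Γ u v)
    weight≡0⇔ = mk⇔
      (λ sum≡0 u v → to (term≡0⇔ u v) (to (row≡0⇔ u) (to rows≡0⇔ sum≡0 u) v))
      (λ none → from rows≡0⇔ λ u → from (row≡0⇔ u) λ v → from (term≡0⇔ u v) (none u v))

  module _ (A B : Subset N) where

    private
      pair : Fin N → Fin N → ℚ
      pair u v = ind A u * ind B v

      signed : (Sign → ℚ) → Fin N → Fin N → ℚ
      signed c u v = pair u v * c (σ Γ u v)

      signed-bit : ∀ {c} → (∀ s → IsBit (c s)) → ∀ u v → IsBit (signed c u v)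
      signed-bit c-bit u v = bit-* (ind*ind-bit A B u v) (c-bit (σ Γ u v))

      noEdges⇔ : ∀ {P : Sign → Set} (g : Fin N → Fin N → ℚ) →
                 (∀ {u v} → g u v ≡ 1ℚ ⇔ ((u ∈ A × v ∈ B) × P (σ Γ u v))) →
                 (∀ u v → g u v ≡ 1ℚ → ¬ Adj Γ u v) ⇔ NoEdges A B P
      noEdges⇔ g g≡1⇔ = mk⇔
        (λ none {u} {v} u∈A v∈B p → none u v (from g≡1⇔ ((u∈A , v∈B) , p)))
        (λ none u v g≡1 → let ((u∈A , v∈B) , p) = to g≡1⇔ g≡1 in none u∈A v∈B p)

      signed≡0⇔ : ∀ {c : Sign → ℚ} {P : Sign → Set} → (∀ s → IsBit (c s)) → (∀ {s} → c s ≡ 1ℚ ⇔ P s) →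
                  (sumFin λ u → sumFin λ v → signed c u v * w Γ u v) ≡ 0ℚ ⇔ NoEdges A B P
      signed≡0⇔ {c} {P} c-bit c≡1⇔ =
        noEdges⇔ {P = P} (signed c)
          (λ {u} {v} → (ind*ind≡1⇔ ×-⇔ c≡1⇔ {σ Γ u v}) ⇔-∘ bit-*≡1⇔ (ind*ind-bit A B u v) (c-bit (σ Γ u v)))
        ⇔-∘ weight≡0⇔ (signed c) (signed-bit c-bit)

    E-nonneg : 0ℚ ℚ.≤ E Γ A B
    E-nonneg = weight-nonneg pair (ind*ind-bit A B)

    E⁺-nonneg : 0ℚ ℚ.≤ E⁺ Γ A B
    E⁺-nonneg = weight-nonneg (signed isPos) (signed-bit isPos-bit)

    E⁻-nonneg : 0ℚ ℚ.≤ E⁻ Γ A B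
    E⁻-nonneg = weight-nonneg (signed isNeg) (signed-bit isNeg-bit)

    E≡0⇔ : E Γ A B ≡ 0ℚ ⇔ NoEdges A B (λ _ → ⊤)
    E≡0⇔ = noEdges⇔ pair (mk⇔ (λ e → to ind*ind≡1⇔ e , tt) (from ind*ind≡1⇔ ∘ proj₁))
       ⇔-∘ weight≡0⇔ pair (ind*ind-bit A B)

    E⁺≡0⇔ : E⁺ Γ A B ≡ 0ℚ ⇔ NoEdges A B (_≡ Sign.+)
    E⁺≡0⇔ = signed≡0⇔ isPos-bit (λ {s} → isPos≡1⇔ {s})

    E⁻≡0⇔ : E⁻ Γ A B ≡ 0ℚ ⇔ NoEdges A B (_≡ Sign.-)
    E⁻≡0⇔ = signed≡0⇔ isNeg-bit (λ {s} → isNeg≡1⇔ {s})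

  βNumerator : Subset N → Subset N → ℚ
  βNumerator V₁ V₂ = (1ℚ + 1ℚ) * E⁺ Γ V₁ V₂ + E⁻ Γ V₁ V₁ + E⁻ Γ V₂ V₂ + E Γ (V₁ ∪ V₂) (∁ (V₁ ∪ V₂))

  βNumerator-nonneg : ∀ V₁ V₂ → 0ℚ ℚ.≤ βNumerator V₁ V₂
  βNumerator-nonneg V₁ V₂ =
    +-mono-≤ (+-mono-≤ (+-mono-≤ (double-nonneg (E⁺-nonneg V₁ V₂)) (E⁻-nonneg V₁ V₁)) (E⁻-nonneg V₂ V₂))
             (E-nonneg (V₁ ∪ V₂) (∁ (V₁ ∪ V₂)))

  βNumerator≡0⇔ : βNumerator V₁ V₂ ≡ 0ℚ ⇔ IsHararyBipartition V₁ V₂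
  βNumerator≡0⇔ {V₁} {V₂} = mk⇔ βNumerator≡0⇒harary harary⇒βNumerator≡0
    where
    U = V₁ ∪ V₂
    2E⁺-nonneg = double-nonneg (E⁺-nonneg V₁ V₂)
    split₁ = +-nonneg≡0⇔ 2E⁺-nonneg (E⁻-nonneg V₁ V₁)
    split₂ = +-nonneg≡0⇔ (+-mono-≤ 2E⁺-nonneg (E⁻-nonneg V₁ V₁)) (E⁻-nonneg V₂ V₂)
    split₃ = +-nonneg≡0⇔ (+-mono-≤ (+-mono-≤ 2E⁺-nonneg (E⁻-nonneg V₁ V₁)) (E⁻-nonneg V₂ V₂)) (E-nonneg U (∁ U))

    βNumerator≡0⇒harary : βNumerator V₁ V₂ ≡ 0ℚ → IsHararyBipartition V₁ V₂
    βNumerator≡0⇒harary num≡0 =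
      let (first₃≡0 , E-boundary≡0) = to split₃ num≡0
          (first₂≡0 , E⁻₂≡0)        = to split₂ first₃≡0
          (2E⁺≡0 , E⁻₁≡0)           = to split₁ first₂≡0
      in record
        { no-positive-across  = to (E⁺≡0⇔ V₁ V₂) (to (double≡0⇔ (E⁺-nonneg V₁ V₂)) 2E⁺≡0)
        ; no-negative-within₁ = to (E⁻≡0⇔ V₁ V₁) E⁻₁≡0
        ; no-negative-within₂ = to (E⁻≡0⇔ V₂ V₂) E⁻₂≡0
        ; no-boundary         = to (E≡0⇔ U (∁ U)) E-boundary≡0
        }

    harary⇒βNumerator≡0 : IsHararyBipartition V₁ V₂ → βNumerator V₁ V₂ ≡ 0ℚ
    harary⇒βNumerator≡0 harary = from split₃
      ( from split₂
          ( from split₁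
              ( from (double≡0⇔ (E⁺-nonneg V₁ V₂)) (from (E⁺≡0⇔ V₁ V₂) no-positive-across)
              , from (E⁻≡0⇔ V₁ V₁) no-negative-within₁ )
          , from (E⁻≡0⇔ V₂ V₂) no-negative-within₂ )
      , from (E≡0⇔ U (∁ U)) no-boundary )
      where open IsHararyBipartition harary

  module _ (μ : Fin N → ℚ) where

    vol-positive : PositiveMeasure N μ → ∀ {S} → Nonempty S → 0ℚ ℚ.< vol Γ μ S
    vol-positive μ>0 {S} (x , x∈S) =
      <-≤-trans (subst (0ℚ ℚ.<_) (sym term≡μx) (μ>0 x)) (term≤sumFin _ term-nonneg x)
      where
      term≡μx : ind S x * μ x ≡ μ x
      term≡μx = trans (cong (_* μ x) (from ind≡1⇔ x∈S)) (*-identityˡ (μ x))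
      term-nonneg : ∀ u → 0ℚ ℚ.≤ ind S u * μ u
      term-nonneg u = bit-*-nonneg (ind-bit S u) (<⇒≤ (μ>0 u))

    β≡βNumerator÷vol : (vol≢0 : vol Γ μ (V₁ ∪ V₂) ≢ 0ℚ) →
                       β Γ μ V₁ V₂ ≡ (βNumerator V₁ V₂ ÷ vol Γ μ (V₁ ∪ V₂)) {{≢-nonZero vol≢0}}
    β≡βNumerator÷vol {V₁} {V₂} vol≢0 with vol Γ μ (V₁ ∪ V₂) ≟ 0ℚ
    ... | yes vol≡0 = ⊥-elim (vol≢0 vol≡0)
    ... | no _      = refl

    module _ (μ>0 : PositiveMeasure N μ) (nonempty : Nonempty (V₁ ∪ V₂)) where

      private
        vol>0 : 0ℚ ℚ.< vol Γ μ (V₁ ∪ V₂)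
        vol>0 = vol-positive μ>0 nonempty
        vol≢0 : vol Γ μ (V₁ ∪ V₂) ≢ 0ℚ
        vol≢0 vol≡0 = <-irrefl (sym vol≡0) vol>0
        instance
          _ = ≢-nonZero vol≢0

      β-nonneg : 0ℚ ℚ.≤ β Γ μ V₁ V₂
      β-nonneg = subst (0ℚ ℚ.≤_) (sym (β≡βNumerator÷vol vol≢0)) (÷-nonneg (βNumerator-nonneg V₁ V₂) vol>0)

      β≡0⇒harary : β Γ μ V₁ V₂ ≡ 0ℚ → IsHararyBipartition V₁ V₂
      β≡0⇒harary β≡0 = to βNumerator≡0⇔ (to ÷≡0⇔ (trans (sym (β≡βNumerator÷vol vol≢0)) β≡0))

    harary⇒β≡0 : IsHararyBipartition V₁ V₂ → β Γ μ V₁ V₂ ≡ 0ℚ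
    harary⇒β≡0 {V₁} {V₂} harary with vol Γ μ (V₁ ∪ V₂) ≟ 0ℚ
    ... | yes _    = refl
    ... | no vol≢0 = from (÷≡0⇔ {{≢-nonZero vol≢0}}) (from βNumerator≡0⇔ harary)

    β≤maxβ : ∀ {k} (T : Fin k → Subset N × Subset N) i → β Γ μ (proj₁ (T i)) (proj₂ (T i)) ℚ.≤ maxβ Γ μ T
    β≤maxβ T = term≤maxFin (λ i → β Γ μ (proj₁ (T i)) (proj₂ (T i)))

    maxβ-nonneg : PositiveMeasure N μ → ∀ {k} {T : Fin (suc k) → Subset N × Subset N} →
                  IsAdmissible (suc k) T → 0ℚ ℚ.≤ maxβ Γ μ T
    maxβ-nonneg μ>0 {T = T} (subBipartition , _) =
      ≤-trans (β-nonneg μ>0 (proj₂ (subBipartition zero))) (β≤maxβ T zero)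

    admissible-zero⇒balancedComponents : PositiveMeasure N μ → ∀ {k T} → IsAdmissible k T → maxβ Γ μ T ≡ 0ℚ →
                                          HasBalancedComponents Γ k
    admissible-zero⇒balancedComponents μ>0 {k} {T} (subBipartition , disjoint) maxβ≡0 =
      C , (λ i → component-isComponent (root i) , balanced i) , distinct
      where
      left right U : Fin k → Subset N
      left = proj₁ ∘ T
      right = proj₂ ∘ T
      U i = left i ∪ right i
      root : Fin k → Fin N
      root i = proj₁ (proj₂ (subBipartition i))
      root∈U : ∀ i → root i ∈ U i
      root∈U i = proj₂ (proj₂ (subBipartition i))
      β≡0 : ∀ i → β Γ μ (left i) (right i) ≡ 0ℚ
      β≡0 i = ≤-antisym (subst (β Γ μ (left i) (right i) ℚ.≤_) maxβ≡0 (β≤maxβ T i))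
                        (β-nonneg μ>0 (proj₂ (subBipartition i)))
      harary : ∀ i → IsHararyBipartition (left i) (right i)
      harary i = β≡0⇒harary μ>0 (proj₂ (subBipartition i)) (β≡0 i)
      C : Fin k → Subset N
      C i = component (root i)
      C⊆U : ∀ i → C i ⊆ U i
      C⊆U i x∈C = Closed-Reach (harary-Closed (harary i)) (root∈U i) (to ∈-component⇔ x∈C)
      balanced : ∀ i → Balanced Γ (C i)
      balanced i = switching⇒Balanced {s = hararySign (left i)} λ x∈C y∈C →
        harary-switching (harary i) (proj₁ (subBipartition i)) (C⊆U i x∈C) (C⊆U i y∈C)
      distinct : ∀ i j → i ≢ j → C i ≢ C j
      distinct i j i≢j Ci≡Cj = ∉⊥ (subst (root i ∈_) (disjoint i j i≢j) (x∈p∩q⁺ (root∈U i , C⊆U j root∈Cj)))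
        where
        root∈Cj : root i ∈ C j
        root∈Cj = subst (root i ∈_) Ci≡Cj (from ∈-component⇔ here)

    balancedComponents⇒admissible-zero : ∀ {k} → HasBalancedComponents Γ k →
                                          Σ (Fin k → Subset N × Subset N) λ T → IsAdmissible k T × maxβ Γ μ T ≡ 0ℚ
    balancedComponents⇒admissible-zero {k} (C , isBalancedComponent , distinct) =
      T , (subBipartition , disjoint) , maxFin-zero _ (λ i → harary⇒β≡0 (harary i))
      where
      isComponent : ∀ i → IsComponent Γ (C i)
      isComponent i = proj₁ (isBalancedComponent i)
      switching : ∀ i → ∃ (IsSwitching (C i))
      switching i = balancedComponent-switching (isComponent i) (proj₂ (isBalancedComponent i))
      T : Fin k → Subset N × Subset N
      T i = signPart (C i) (proj₁ (switching i)) Sign.+ , signPart (C i) (proj₁ (switching i)) Sign.-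
      harary : ∀ i → IsHararyBipartition (proj₁ (T i)) (proj₂ (T i))
      harary i = switching-harary (IsComponent⇒Closed (isComponent i)) (proj₂ (switching i))
      subBipartition : ∀ i → IsSubBipartition (proj₁ (T i)) (proj₂ (T i))
      subBipartition i =
        let (r , r∈C) = proj₁ (isComponent i) in signParts-disjoint , r , from ∈-signParts⇔ r∈C
      disjoint : ∀ i j → i ≢ j → (proj₁ (T i) ∪ proj₂ (T i)) ∩ (proj₁ (T j) ∪ proj₂ (T j)) ≡ ⊥
      disjoint i j i≢j = Empty-unique λ (x , x∈) →
        let (x∈i , x∈j) = x∈p∩q⁻ _ _ x∈ in
        distinct i j i≢j (IsComponent-≡ (isComponent i) (isComponent j) (to ∈-signParts⇔ x∈i) (to ∈-signParts⇔ x∈j))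

proposition3p7 : (N : ℕ) (Γ : SignedGraph N) (μ : Fin N → ℚ) → PositiveMeasure N μ →
    (k : ℕ) → 1 ≤ k → k ≤ N → (h : ℚ) → IsHk Γ μ k h →
    (h ≡ 0ℚ ⇔ HasBalancedComponents Γ k)
proposition3p7 N Γ μ μ>0 zero    () _ _ _
proposition3p7 N Γ μ μ>0 (suc k) _  _ h ((T₀ , admissible₀ , maxβ≡h) , h-minimal) = mk⇔
  (λ h≡0 → admissible-zero⇒balancedComponents Γ μ μ>0 admissible₀ (trans maxβ≡h h≡0))
  (λ balancedComponents →
     let (T , admissible , maxβ≡0) = balancedComponents⇒admissible-zero Γ μ balancedComponents
     in ≤-antisym (subst (h ℚ.≤_) maxβ≡0 (h-minimal T admissible))
                  (subst (0ℚ ℚ.≤_) maxβ≡h (maxβ-nonneg Γ μ μ>0 admissible₀)))
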